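{- Let $t \geq 5$ be an integer. If $G$ is a connected graph on $n$ vertices satisfying $\sigma_2(G) > \frac{t-3}{t-2}n$, then $G$ has either a Hamiltonian path or an induced subgraph isomorphic to $K_{1,t}$.
   Context: All graphs are finite and simple. A Hamiltonian path of $G$ is a path containing all vertices of $G$. For a graph $G$, $\sigma_2(G)$ denotes the minimum of $\deg(x)+\deg(y)$ over all pairs of distinct nonadjacent vertices $x,y$ of $G$. $K_{1,t}$ denotes the star with one center vertex adjacent to $t$ pairwise nonadjacent leaves. -}

module Defs where

open import Data.Empty using (⊥)
open import Data.Fin.Base using (Fin)
open import Data.Fin.Properties using (_≟_)
open import Data.Fin.Subset using (Subset; _∈_)
open import Data.Integer.Base using (+_)
open import Data.List.Base using (List; length; filter; map; allFin; cartesianProduct)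
open import Data.List.Extrema using (min)
import Data.List.Membership.Propositional as List
open import Data.List.Relation.Unary.Linked using (Linked)
open import Data.List.Relation.Unary.Unique.Propositional using (Unique)
open import Data.Maybe.Base using () renaming (map to map⁺)
open import Data.Nat.Base using (ℕ; _+_; _∸_; _≤_; _≥_; NonZero; s≤s)
open import Data.Nat.Properties using (≤-isTotalOrder)
open import Data.Product.Base using (Σ-syntax; ∃; _×_; _,_; proj₁)
open import Data.Rational.Unnormalised.Base as ℚᵘ using (ℚᵘ)
open import Data.Sum.Base using (_⊎_; inj₁; inj₂)
open import Data.Unit.Base using (⊤; tt)
open import Function.Bundles using (_↔_; _⇔_; Inverse)
open import Level using (0ℓ)
open import Relation.Binary.Bundles using (TotalOrder)
import Relation.Binary.Construct.Add.Supremum.NonStrict as NonStrict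
import Relation.Binary.Construct.Add.Supremum.Strict as Strict
open import Relation.Binary.Construct.Closure.ReflexiveTransitive using (Star)
open import Relation.Binary.Core using (Rel)
open import Relation.Binary.Definitions using (Decidable; Symmetric)
open import Relation.Nullary.Construct.Add.Supremum using (_⁺; ⊤⁺; [_])
open import Relation.Nullary.Decidable using (yes; no; ¬?; _×-dec_)
open import Relation.Nullary.Negation using (¬_)

-- Adjacency is decidable, as it is classically for every finite graph.
record Graph (V : Set) : Set₁ where
  field
    Adj    : Rel V 0ℓ
    adj?   : Decidable Adj
    sym    : Symmetric Adj
    irrefl : ∀ v → ¬ Adj v v

open Graph public using (Adj; adj?)

-- The null graph is not connected.
record Connected {V : Set} (G : Graph V) : Set where
  field
    nonempty : V
    linked   : ∀ u v → Star (Adj G) u v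

record IsPath {V : Set} (G : Graph V) (vs : List V) : Set where
  field
    consecutive : Linked (Adj G) vs
    distinct    : Unique vs

HasHamiltonianPath : {V : Set} → Graph V → Set
HasHamiltonianPath G = ∃ λ vs → IsPath G vs × (∀ v → v List.∈ vs)

deg : ∀ {n} → Graph (Fin n) → Fin n → ℕ
deg {n} G v = length (filter (adj? G v) (allFin n))

nonadjacentPairs : ∀ {n} → Graph (Fin n) → List (Fin n × Fin n)
nonadjacentPairs {n} G =
  filter (λ (x , y) → ¬? (x ≟ y) ×-dec ¬? (adj? G x y))
         (cartesianProduct (allFin n) (allFin n))

ℕ⁺-totalOrder : TotalOrder 0ℓ 0ℓ 0ℓ
ℕ⁺-totalOrder = record
  { isTotalOrder = NonStrict.≤⁺-isTotalOrder-≡ _≤_ ≤-isTotalOrder }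

-- σ₂ takes values in ℕ ∪ {∞}: for a complete graph the minimum is over the
-- empty set, hence is ∞ = ⊤⁺.
σ₂ : ∀ {n} → Graph (Fin n) → ℕ ⁺
σ₂ G = min ℕ⁺-totalOrder ⊤⁺
         (map (λ (x , y) → [ deg G x + deg G y ]) (nonadjacentPairs G))

fromℕ : ℕ → ℚᵘ
fromℕ k = + k ℚᵘ./ 1

infix 4 _>⁺_

_>⁺_ : ℕ ⁺ → ℚᵘ → Set
k >⁺ q = Strict._<⁺_ ℚᵘ._<_ [ q ] (map⁺ fromℕ k)

t∸2-nonZero : ∀ {t} → t ≥ 5 → NonZero (t ∸ 2)
t∸2-nonZero (s≤s (s≤s (s≤s _))) = _

-- (t - 3) / (t - 2); the truncated subtractions are exact since t ≥ 5.
ratio : (t : ℕ) → t ≥ 5 → ℚᵘ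
ratio t t≥5 = ℚᵘ._/_ (+ (t ∸ 3)) (t ∸ 2) {{t∸2-nonZero t≥5}}

-- inj₁ tt is the centre, inj₂ i are the leaves.
K₁,_ : (t : ℕ) → Graph (⊤ ⊎ Fin t)
K₁, t = record
  { Adj    = StarAdj
  ; adj?   = starAdj?
  ; sym    = λ {u} {v} → starSym u v
  ; irrefl = λ { (inj₁ _) () ; (inj₂ _) () }
  }
  where
  StarAdj : Rel (⊤ ⊎ Fin t) 0ℓ
  StarAdj (inj₁ _) (inj₁ _) = ⊥
  StarAdj (inj₁ _) (inj₂ _) = ⊤
  StarAdj (inj₂ _) (inj₁ _) = ⊤
  StarAdj (inj₂ _) (inj₂ _) = ⊥

  starAdj? : Decidable StarAdj
  starAdj? (inj₁ _) (inj₁ _) = no λ ()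
  starAdj? (inj₁ _) (inj₂ _) = yes tt
  starAdj? (inj₂ _) (inj₁ _) = yes tt
  starAdj? (inj₂ _) (inj₂ _) = no λ ()

  starSym : ∀ u v → StarAdj u v → StarAdj v u
  starSym (inj₁ _) (inj₂ _) _ = tt
  starSym (inj₂ _) (inj₁ _) _ = tt

induced : ∀ {n} → Graph (Fin n) → (S : Subset n) → Graph (Σ[ v ∈ Fin n ] v ∈ S)
induced G S = record
  { Adj    = λ u v → Adj G (proj₁ u) (proj₁ v)
  ; adj?   = λ u v → adj? G (proj₁ u) (proj₁ v)
  ; sym    = Graph.sym G
  ; irrefl = λ v → Graph.irrefl G (proj₁ v)
  }

infix 4 _≅_

record _≅_ {V W : Set} (G : Graph V) (H : Graph W) : Set where
  field
    bijection : V ↔ W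
    adjacency : ∀ u v → Adj G u v ⇔ Adj H (Inverse.to bijection u) (Inverse.to bijection v)

HasInduced : ∀ {n} {W : Set} → Graph (Fin n) → Graph W → Set
HasInduced {n} G H = Σ[ S ∈ Subset n ] (induced G S ≅ H)

{-# OPTIONS --safe #-}

-- Let P = s ⋯ e be a longest path that misses a vertex, let x ∉ P be adjacent to
-- a ∈ P, and let u be the successor of a on P.  Rotating P at a shows that
-- deg s + deg u ≤ n - 2, and, if x had a neighbour y ∉ P, that
-- deg s + deg u + deg y ≤ n; the latter contradicts σ₂ > 2n/3, so all neighbours
-- of x lie on P.  The set I consisting of x, s and the successors on P of the
-- neighbours of x is then independent, and |I| = deg x + 2.  If no vertex had t
-- neighbours in I, double counting the edges leaving I would give
-- Σ_I deg ≤ (t - 1)(n - |I|).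
--
-- If 2 deg x ≥ σ₂, this is too small because degrees in I sum to at least σ₂ in
-- pairs.  If 2 deg x < σ₂ and e ∈ I, exchange x and e, which has large degree.
-- Finally, if 2 deg x < σ₂ and e ∉ I, then e has at most one neighbour in I, and
-- this gain, together with deg ≥ σ₂ - deg x on I \ {x}, gives a contradiction again.
module Submission where

open import Defs
open import Data.Fin.Base using (Fin)
open import Data.Nat.Base using (ℕ; _≥_)
open import Data.Sum.Base using (_⊎_)

import Algebra.Solver.CommutativeMonoid as CommutativeMonoidSolver
open import Data.Bool.Base using (true; if_then_else_)
open import Data.Fin.Base using (zero; suc; inject≤)
open import Data.Fin.Properties using (_≟_; any?; all?; ¬∀⟶∃¬; inject≤-injective)
open import Data.Fin.Subset using (Subset) renaming (_∈_ to _∈ₛ_)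
import Data.Integer.Base as ℤ
import Data.Integer.Properties as ℤ
open import Data.List.Base using (List; []; _∷_; _++_; length; map; filter; lookup; allFin)
open import Data.List.Extrema using (min≤xs)
open import Data.List.Membership.DecPropositional using (_∈?_)
open import Data.List.Membership.Propositional using (_∈_; _∉_)
open import Data.List.Membership.Propositional.Properties
  using (∈-∃++; ∈-++⁺ʳ; ∈-lookup; ∈-allFin; ∈-map⁺; ∈-filter⁺; ∈-cartesianProduct⁺)
open import Data.List.Properties using (length-++; length-tabulate; map-++; ++-assoc)
open import Data.List.Relation.Binary.Permutation.Propositional
  using (_↭_; ↭-refl; ↭-sym; ↭-trans; ↭⇒↭ₛ; prep)
open import Data.List.Relation.Binary.Permutation.Propositional.Properties as ↭
  using (∈-resp-↭; ↭-length; shift)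
import Data.List.Relation.Binary.Permutation.Setoid.Properties as ↭ₛ
open import Data.List.Relation.Unary.All as All using (All; []; _∷_)
import Data.List.Relation.Unary.All.Properties as All
open import Data.List.Relation.Unary.AllPairs as AllPairs using (AllPairs; []; _∷_; allPairs?)
import Data.List.Relation.Unary.AllPairs.Properties as AllPairs
open import Data.List.Relation.Unary.Any using (here; there)
open import Data.List.Relation.Unary.Linked using (Linked; []; [-]; _∷_; linked?)
open import Data.List.Relation.Unary.Unique.Propositional using (Unique)
import Data.List.Relation.Unary.Unique.Propositional.Properties as Unique
open import Data.Nat.Base as Nat using (zero; suc; _+_; _≤_; _<_; z≤n; s≤s)
open import Data.Nat.ListAction using (sum)
open import Data.Nat.ListAction.Properties using (sum-++; sum-↭)
open import Data.Nat.Properties hiding (_≟_)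
open import Data.Nat.Tactic.RingSolver using (solve-∀)
open import Data.Product.Base using (Σ; ∃; _×_; _,_; proj₁; proj₂)
import Data.Rational.Unnormalised.Base as ℚᵘ
open import Data.Sum.Base using (inj₁; inj₂)
open import Data.Unit.Base using (⊤; tt)
open import Data.Vec.Base using (tabulate)
open import Data.Vec.Properties using (lookup⇒[]=; []=⇒lookup; lookup∘tabulate)
open import Data.Vec.Properties.WithK using ([]=-irrelevant)
open import Function.Bundles using (_⇔_; mk⇔; mk↔ₛ′)
open import Level using (0ℓ)
open import Relation.Binary.Bundles using (TotalOrder)
open import Relation.Binary.Construct.Add.Supremum.NonStrict using ([≤]-injective)
open import Relation.Binary.Construct.Add.Supremum.Strict using ([_])
open import Relation.Binary.Construct.Closure.ReflexiveTransitive using (Star; ε; _◅_)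
open import Relation.Binary.Core using (Rel)
open import Relation.Binary.Definitions using (Symmetric)
open import Relation.Binary.PropositionalEquality
  using (_≡_; _≢_; refl; sym; trans; cong; cong₂; subst; subst₂; setoid; module ≡-Reasoning)
open import Relation.Nullary.Construct.Add.Supremum using (⊤⁺; [_])
open import Relation.Nullary.Decidable using (Dec; yes; no; does; dec-true; map′; _×-dec_; ¬?)
open import Relation.Nullary.Negation using (¬_; contradiction)
open import Relation.Unary using (Pred; Decidable)

-- Linear arithmetic by certificate: a ≤ b is the combination of hypotheses and r the slack.
farkas : ∀ {a b} x y r → a ≤ b → x + b + r ≡ y + a → x ≤ y
farkas {a} {b} x y r a≤b eq = +-cancelʳ-≤ a x y (begin
  x + a      ≤⟨ +-monoʳ-≤ x a≤b ⟩
  x + b      ≤⟨ m≤m+n (x + b) r ⟩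
  x + b + r  ≡⟨ eq ⟩
  y + a      ∎)
  where open ≤-Reasoning

-- Duplicate-free lists up to permutation

module _ {A : Set} where

  Unique-resp-↭ : {xs ys : List A} → xs ↭ ys → Unique xs → Unique ys
  Unique-resp-↭ p = ↭ₛ.Unique-resp-↭ (setoid A) (↭⇒↭ₛ p)

  -- Move `x` to the front of `ys` and recurse: since `xs` has no repetition, its other entries are
  -- still found in what remains. With `ys` the list of all vertices, `zs` is the complement of
  -- `xs`.
  extract : {xs ys : List A} → Unique xs → (∀ {v} → v ∈ xs → v ∈ ys) →
            ∃ λ zs → ys ↭ xs ++ zs
  extract {[]} {ys} _ _ = ys , ↭-refl
  extract {x ∷ xs} (x∉xs ∷ xs!) xs⊆ys with ∈-∃++ (xs⊆ys (here refl))
  ... | as , bs , refl =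
    let zs , p = extract xs! (λ v∈xs → rest v∈xs (∈-resp-↭ (shift x as bs) (xs⊆ys (there v∈xs))))
    in zs , ↭-trans (shift x as bs) (prep x p)
    where
    rest : ∀ {v} → v ∈ xs → v ∈ x ∷ as ++ bs → v ∈ as ++ bs
    rest v∈xs (here refl) = contradiction refl (All.lookup x∉xs v∈xs)
    rest v∈xs (there v∈)  = v∈

  Unique-++⁻ʳ : ∀ xs {ys : List A} → Unique (xs ++ ys) → Unique ys
  Unique-++⁻ʳ []       ys!       = ys!
  Unique-++⁻ʳ (x ∷ xs) (_ ∷ xs!) = Unique-++⁻ʳ xs xs!

  ++-disjoint : ∀ {a b} xs {ys : List A} → Unique (xs ++ ys) → a ∈ xs → b ∈ ys → a ≢ b
  ++-disjoint (x ∷ xs) (x∉ ∷ _)   (here refl) b∈ = All.lookup x∉ (∈-++⁺ʳ xs b∈)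
  ++-disjoint (x ∷ xs) (_ ∷ xs!) (there a∈)   b∈ = ++-disjoint xs xs! a∈ b∈

  ∉⇒Unique : ∀ {x} {xs : List A} → x ∉ xs → Unique xs → Unique (x ∷ xs)
  ∉⇒Unique x∉xs xs! = All.tabulate (λ v∈xs x≡v → x∉xs (subst (_∈ _) (sym x≡v) v∈xs)) ∷ xs!

-- Counting with 0-1 indicators

bit : {P : Set} → Dec P → ℕ
bit P? = if does P? then 1 else 0

bit≤1 : {P : Set} (P? : Dec P) → bit P? ≤ 1
bit≤1 (yes _) = s≤s z≤n
bit≤1 (no  _) = z≤n

bit-no : {P : Set} (P? : Dec P) → ¬ P → bit P? ≡ 0
bit-no (yes p) ¬p = contradiction p ¬p
bit-no (no  _) ¬p = refl

bit-yes : {P : Set} (P? : Dec P) → P → bit P? ≡ 1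
bit-yes (yes _) p = refl
bit-yes (no ¬p) p = contradiction p ¬p

bit-disjoint : {P Q : Set} (P? : Dec P) (Q? : Dec Q) → (P → ¬ Q) → bit P? + bit Q? ≤ 1
bit-disjoint (yes p) (yes q) d = contradiction q (d p)
bit-disjoint (yes _) (no  _) d = s≤s z≤n
bit-disjoint (no  _) Q?      d = bit≤1 Q?

module _ {A : Set} {P : Pred A 0ℓ} (P? : Decidable P) where

  count : List A → ℕ
  count xs = sum (map (λ x → bit (P? x)) xs)

  length-filter : ∀ xs → length (filter P? xs) ≡ count xs
  length-filter []       = refl
  length-filter (x ∷ xs) with P? x
  ... | yes _ = cong suc (length-filter xs)
  ... | no  _ = length-filter xs

  count-↭ : ∀ {xs ys} → xs ↭ ys → count xs ≡ count ys
  count-↭ p = sum-↭ (↭.map⁺ _ p)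

  count-++ : ∀ xs ys → count (xs ++ ys) ≡ count xs + count ys
  count-++ xs ys = trans (cong sum (map-++ _ xs ys)) (sum-++ (map _ xs) (map _ ys))

  count≤length : ∀ xs → count xs ≤ length xs
  count≤length []       = z≤n
  count≤length (x ∷ xs) = +-mono-≤ (bit≤1 (P? x)) (count≤length xs)

  count-none : ∀ {xs} → (∀ {x} → x ∈ xs → ¬ P x) → count xs ≡ 0
  count-none {[]}     none = refl
  count-none {x ∷ xs} none = cong₂ _+_ (bit-no (P? x) (none (here refl))) (count-none (λ x∈ → none (there x∈)))

  -- The hypothesis makes `P` fail at every entry that has a later one, so only the last entry can
  -- contribute.
  count-atMostOne : ∀ {xs} → AllPairs (λ x _ → ¬ P x) xs → count xs ≤ 1
  count-atMostOne [] = z≤n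
  count-atMostOne {x ∷ []}     _ = ≤-trans (≤-reflexive (+-identityʳ _)) (bit≤1 (P? x))
  count-atMostOne {x ∷ y ∷ xs} ((¬px ∷ _) ∷ pxs) rewrite bit-no (P? x) ¬px = count-atMostOne pxs

count-disjoint : {A : Set} {P Q : Pred A 0ℓ} (P? : Decidable P) (Q? : Decidable Q) →
                 ∀ {xs} → (∀ {x} → x ∈ xs → P x → ¬ Q x) → count P? xs + count Q? xs ≤ length xs
count-disjoint P? Q? {[]}     d = z≤n
count-disjoint P? Q? {x ∷ xs} d = farkas _ _ 0
  (+-mono-≤ (bit-disjoint (P? x) (Q? x) (d (here refl))) (count-disjoint P? Q? {xs} (λ x∈ → d (there x∈))))
  (lemma (bit (P? x)) (count P? xs) (bit (Q? x)) (count Q? xs) (length xs))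
  where
  lemma : ∀ p ps q qs l → p + ps + (q + qs) + (1 + l) + 0 ≡ 1 + l + (p + q + (ps + qs))
  lemma = solve-∀

-- Walks, their cuts, and successors of marked vertices

module Walks {A : Set} (_~_ : Rel A 0ℓ) (~-sym : Symmetric _~_) where

  data Walk : A → A → List A → Set where
    [-] : ∀ {a} → Walk a a (a ∷ [])
    _∷_ : ∀ {a b c xs} → a ~ b → Walk b c xs → Walk a c (a ∷ xs)

  -- Reversing a piece of a walk does not change the vertices it visits, so
  -- vertices are only recorded up to permutation.
  Span : A → A → List A → Set
  Span a b xs = ∃ λ ys → Walk a b ys × ys ↭ xs

  ⌞_⌟ : ∀ {a b xs} → Walk a b xs → Span a b xs
  ⌞ w ⌟ = _ , w , ↭-refl

  append : ∀ {a b c d xs ys} → Walk a b xs → b ~ c → Walk c d ys → Walk a d (xs ++ ys)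
  append [-]      e v = e ∷ v
  append (e′ ∷ w) e v = e′ ∷ append w e v

  infixr 5 _▸⟨_⟩_

  _▸⟨_⟩_ : ∀ {a b c d xs ys} → Span a b xs → b ~ c → Span c d ys → Span a d (xs ++ ys)
  (_ , w , p) ▸⟨ e ⟩ (_ , v , q) = _ , append w e v , ↭.++⁺ p q

  rev : ∀ {a b xs} → Walk a b xs → Span b a xs
  rev [-] = ⌞ [-] ⌟
  rev (_∷_ {a} {xs = xs} e w) with rev w
  ... | ys , v , p = ys ++ a ∷ [] , append v (~-sym e) [-] ,
    ↭-trans (↭.++-comm ys (a ∷ [])) (prep a p)

  start∈ : ∀ {a b xs} → Walk a b xs → a ∈ xs
  start∈ [-]     = here refl
  start∈ (_ ∷ _) = here refl

  end∈ : ∀ {a b xs} → Walk a b xs → b ∈ xs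
  end∈ [-]     = here refl
  end∈ (_ ∷ w) = there (end∈ w)

  0<length : ∀ {a b xs} → Walk a b xs → 0 < length xs
  0<length [-]     = s≤s z≤n
  0<length (_ ∷ _) = s≤s z≤n

  -- A rotation removes an edge and reconnects the two pieces, so both pieces are kept as walks in
  -- their own right.
  record Cut (a b : A) (zs : List A) (m m′ : A) : Set where
    constructor cut
    field
      {left right} : List A
      wˡ           : Walk a m left
      edge         : m ~ m′
      wʳ           : Walk m′ b right
      split        : zs ≡ left ++ right

  consCut : ∀ {a b c xs m m′} → a ~ b → Cut b c xs m m′ → Cut a c (a ∷ xs) m m′
  consCut {a} e (cut v e′ w eq) = cut (e ∷ v) e′ w (cong (a ∷_) eq)

  cutAfter : ∀ {a b xs m} → Walk a b xs → m ∈ xs → m ≢ b → ∃ (Cut a b xs m)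
  cutAfter [-]     (here refl) m≢b = contradiction refl m≢b
  cutAfter (e ∷ w) (here refl) m≢b = _ , cut [-] e w refl
  cutAfter (e ∷ w) (there m∈)  m≢b = let _ , c = cutAfter w m∈ m≢b in _ , consCut e c

  cutˡ : ∀ {a b zs m m′} (c : Cut a b zs m m′) {l l′} → Cut a m (Cut.left c) l l′ → Cut a b zs l l′
  cutˡ (cut {_} {R} v e w eq) (cut {L} {M} v′ e′ w′ eq′) =
    cut v′ e′ (append w′ e w) (trans eq (trans (cong (_++ R) eq′) (++-assoc L M R)))

  cutʳ : ∀ {a b zs m m′} (c : Cut a b zs m m′) {l l′} → Cut m′ b (Cut.right c) l l′ → Cut a b zs l l′
  cutʳ (cut {L} v e w eq) (cut {M} {R} v′ e′ w′ eq′) =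
    cut (append v e v′) e′ w′ (trans eq (trans (cong (L ++_) eq′) (sym (++-assoc L M R))))

  module _ {N : Pred A 0ℓ} (N? : Decidable N) where

    nexts : ∀ {a b xs} → Walk a b xs → List A
    nexts [-] = []
    nexts (_∷_ {a} {b} e w) = if does (N? a) then b ∷ nexts w else nexts w

    -- Every marked vertex has a successor except possibly the end `b`, whence the correction term.
    length-nexts : ∀ {a b xs} (w : Walk a b xs) → length (nexts w) + bit (N? b) ≡ count N? xs
    length-nexts [-] = sym (+-identityʳ _)
    length-nexts (_∷_ {a} e w) with N? a
    ... | yes _ = cong suc (length-nexts w)
    ... | no  _ = length-nexts w

    ∈-nexts⁻ : ∀ {a b xs m′} (w : Walk a b xs) → m′ ∈ nexts w → ∃ λ m → Cut a b xs m m′ × N m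
    ∈-nexts⁻ (_∷_ {a} e w) m′∈ with N? a
    ∈-nexts⁻ (_∷_ {a} e w) (here refl) | yes Na = a , cut [-] e w refl , Na
    ∈-nexts⁻ (_∷_ {a} e w) (there m′∈) | yes _  = let m , c , Nm = ∈-nexts⁻ w m′∈ in m , consCut e c , Nm
    ∈-nexts⁻ (_∷_ {a} e w) m′∈         | no  _  = let m , c , Nm = ∈-nexts⁻ w m′∈ in m , consCut e c , Nm

    -- Successors are listed in walk order, so a later one arises from a second cut inside the right
    -- piece of the first. The two cuts leave three consecutive pieces, ready to be rearranged.
    nexts-allPairs : ∀ {a b xs} {R : Rel A 0ℓ} (w : Walk a b xs) →
      (∀ {m m′ l l′} (c : Cut a b xs m m′) → Cut m′ b (Cut.right c) l l′ → N m → N l → R m′ l′) →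
      AllPairs R (nexts w)
    nexts-allPairs [-] h = []
    nexts-allPairs (_∷_ {a} e w) h with N? a
    ... | yes Na = All.tabulate (λ l′∈ → let _ , c , Nl = ∈-nexts⁻ w l′∈ in h (cut [-] e w refl) c Na Nl)
                 ∷ nexts-allPairs w (λ c → h (consCut e c))
    ... | no  _  = nexts-allPairs w (λ c → h (consCut e c))

  -- Charging arguments along a walk

  module _ {F G : Pred A 0ℓ} (F? : Decidable F) (G? : Decidable G) where

    -- Charge every m with F m to itself and every m′ with G m′ to its predecessor.
    count-shifted : ∀ {a b zs} → Walk a b zs →
      (∀ {m m′} → Cut a b zs m m′ → F m → ¬ G m′) →
      suc (count F? zs + count G? zs) ≤ length zs + bit (G? a) + bit (F? b)
    count-shifted {a} [-] h = ≤-reflexive (lemma (bit (F? a)) (bit (G? a)))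
      where
      lemma : ∀ f g → 1 + (f + 0 + (g + 0)) ≡ 1 + g + f
      lemma = solve-∀
    count-shifted {a} {b} (_∷_ {b = c} {xs = xs} e w) h = farkas _ _ 0
      (+-mono-≤ (bit-disjoint (F? a) (G? c) (h (cut [-] e w refl)))
                (count-shifted w (λ k → h (consCut e k))))
      (lemma (bit (F? a)) (count F? xs) (bit (G? a)) (count G? xs) (length xs) (bit (G? c)) (bit (F? b)))
      where
      lemma : ∀ f cf g cg l g′ fe →
        1 + (f + cf + (g + cg)) + (1 + (l + g′ + fe)) + 0 ≡ 1 + l + g + fe + (f + g′ + (1 + (cf + cg)))
      lemma = solve-∀

    module _ {Y : Pred A 0ℓ} (Y? : Decidable Y) where

      -- As before; additionally every m with Y m is charged to itself unless
      -- F m holds, in which case it is charged to its successor.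
      count-three : ∀ {a b zs} → Walk a b zs →
        (∀ {m m′} → Cut a b zs m m′ → F m → ¬ G m′) →
        (∀ {m m′ z X X′} → Walk a m X → Walk m′ b X′ → zs ≡ X ++ z ∷ X′ → F m → ¬ G m′) →
        (∀ {m m′} → Cut a b zs m m′ → Y m → ¬ F m′ × ¬ G m′ × ¬ Y m′) →
        count F? zs + count G? zs + count Y? zs ≤ length zs + bit (G? a) + bit (Y? b)
      count-three {a} [-] h₁ h₂ h₃ = farkas _ _ 0 (bit≤1 (F? a)) (lemma (bit (F? a)) (bit (G? a)) (bit (Y? a)))
        where
        lemma : ∀ f g y → f + 0 + (g + 0) + (y + 0) + 1 + 0 ≡ 1 + g + y + f
        lemma = solve-∀
      count-three {a} {b} (_∷_ {b = c} {xs = xs} e w) h₁ h₂ h₃ = step (Y? a) (F? a)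
        where
        IH = count-three w
          (λ k → h₁ (consCut e k)) (λ v u eq → h₂ (e ∷ v) u (cong (a ∷_) eq)) (λ k → h₃ (consCut e k))
        step : Dec (Y a) → Dec (F a) →
          count F? (a ∷ xs) + count G? (a ∷ xs) + count Y? (a ∷ xs) ≤ suc (length xs) + bit (G? a) + bit (Y? b)
        -- The slot of `a` pays for `F a` or for `G c`, which exclude each other.
        step (no ¬ya) _ rewrite bit-no (Y? a) ¬ya = farkas _ _ 0
          (+-mono-≤ (bit-disjoint (F? a) (G? c) (h₁ (cut [-] e w refl))) IH)
          (lemma (bit (F? a)) (count F? xs) (bit (G? a)) (count G? xs) (count Y? xs)
            (length xs) (bit (G? c)) (bit (Y? b)))
          where
          lemma : ∀ f cf g cg cy l g′ ye →
            f + cf + (g + cg) + (0 + cy) + (1 + (l + g′ + ye)) + 0 ≡ 1 + l + g + ye + (f + g′ + (cf + cg + cy))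
          lemma = solve-∀
        -- The slot of `a` pays for `Y a`, and `h₃` rules out `G c`.
        step (yes ya) (no ¬fa)
          rewrite bit-yes (Y? a) ya | bit-no (F? a) ¬fa = farkas _ _ 0
            (+-mono-≤ (≤-reflexive (bit-no (G? c) (proj₁ (proj₂ (h₃ (cut [-] e w refl) ya))))) IH)
            (lemma (count F? xs) (bit (G? a)) (count G? xs) (count Y? xs)
            (length xs) (bit (G? c)) (bit (Y? b)))
          where
          lemma : ∀ cf g cg cy l g′ ye →
            0 + cf + (g + cg) + (1 + cy) + (0 + (l + g′ + ye)) + 0 ≡ 1 + l + g + ye + (g′ + (cf + cg + cy))
          lemma = solve-∀
        -- The slots of `a` and `c` pay for `F a` and `Y a`. By `h₃` nothing is counted at `c`, and
        -- by `h₂` the vertex after `c` does not satisfy `G`, so the induction resumes there without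
        -- debt.
        step (yes ya) (yes fa) rewrite bit-yes (Y? a) ya | bit-yes (F? a) fa =
          charge w e (λ k → h₁ (consCut e k)) h₂ h₃
          where
          charge : ∀ {c xs} (w : Walk c b xs) → a ~ c →
            (∀ {m m′} → Cut c b xs m m′ → F m → ¬ G m′) →
            (∀ {m m′ z X X′} → Walk a m X → Walk m′ b X′ → a ∷ xs ≡ X ++ z ∷ X′ → F m → ¬ G m′) →
            (∀ {m m′} → Cut a b (a ∷ xs) m m′ → Y m → ¬ F m′ × ¬ G m′ × ¬ Y m′) →
            1 + count F? xs + (bit (G? a) + count G? xs) + (1 + count Y? xs) ≤
              suc (length xs) + bit (G? a) + bit (Y? b)
          charge {c} [-] e h₁′ h₂ h₃
            with ¬fc , ¬gc , ¬yc ← h₃ (cut [-] e [-] refl) ya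
            rewrite bit-no (F? c) ¬fc | bit-no (G? c) ¬gc | bit-no (Y? c) ¬yc = ≤-reflexive (lemma (bit (G? a)))
            where
            lemma : ∀ g → 1 + (g + 0) + 1 ≡ 2 + g + 0
            lemma = solve-∀
          charge {c} (_∷_ {b = d} {xs = xs} e′ w) e h₁′ h₂ h₃
            with ¬fc , ¬gc , ¬yc ← h₃ (cut [-] e (e′ ∷ w) refl) ya
            rewrite bit-no (F? c) ¬fc | bit-no (G? c) ¬gc | bit-no (Y? c) ¬yc = farkas _ _ 0
              (+-mono-≤ (≤-reflexive (bit-no (G? d) (h₂ [-] w refl fa)))
                (count-three w
                  (λ k → h₁′ (consCut e′ k))
                  (λ v u eq → h₂ (e ∷ e′ ∷ v) u (cong (λ ys → a ∷ c ∷ ys) eq))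
                  (λ k → h₃ (consCut e (consCut e′ k)))))
              (lemma (count F? xs) (bit (G? a)) (count G? xs) (count Y? xs)
                (length xs) (bit (G? d)) (bit (Y? b)))
            where
            lemma : ∀ cf g cg cy l g′ ye →
              1 + cf + (g + cg) + (1 + cy) + (0 + (l + g′ + ye)) + 0 ≡ 2 + l + g + ye + (g′ + (cf + cg + cy))
            lemma = solve-∀

-- Extremality of a longest path

module Longest {A : Set} (_~_ : Rel A 0ℓ) (~-sym : Symmetric _~_) where
  open Walks _~_ ~-sym
  open CommutativeMonoidSolver (↭.++-commutativeMonoid {A = A}) using (solve; _⊕_; _⊜_)

  record IsLongest (s e : A) (vs : List A) : Set where
    field
      walk    : Walk s e vs
      unique  : Unique vs
      maximal : ∀ {a b ys} → Walk a b ys → Unique ys → length ys ≤ length vs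

  module _ {s e vs} (P : IsLongest s e vs) where
    open IsLongest P

    -- The span `ys` visits P and `es` except for `zs`. It has no repetition, being part of a
    -- permutation of `es ++ vs`, and it is longer than P because fewer vertices are dropped than
    -- added. `ws` is `vs` written in blocks, so that the permutation to be checked only moves
    -- blocks.
    no-longer : ∀ {a b ws ys} es zs → Unique (es ++ vs) → length zs < length es →
                vs ≡ ws → Span a b ys → ¬ (zs ++ ys ↭ es ++ ws)
    no-longer es zs es! zs<es refl (xs , w , p) q =
      <⇒≱ (begin-strict
             length zs + length vs  <⟨ +-monoˡ-< (length vs) zs<es ⟩
             length es + length vs  ≡⟨ length-++ es ⟨
             length (es ++ vs)      ≡⟨ ↭-length r ⟨
             length (zs ++ xs)      ≡⟨ length-++ zs ⟩
             length zs + length xs  ∎)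
          (+-monoʳ-≤ (length zs) (maximal w (Unique-++⁻ʳ zs (Unique-resp-↭ (↭-sym r) es!))))
      where
      open ≤-Reasoning
      r : zs ++ xs ↭ es ++ vs
      r = ↭-trans (↭.++⁺ˡ zs p) q

    -- `Q` is a path off P to be inserted into P. It serves with a single vertex, with an edge in
    -- either direction, and with three vertices.
    module Detour {q r es} (Q : Walk q r es) (es! : Unique (es ++ vs)) where

      0<es : 0 < length es
      0<es = 0<length Q

      not-before : ¬ r ~ s
      not-before rs = no-longer es [] es! 0<es refl (⌞ Q ⌟ ▸⟨ rs ⟩ ⌞ walk ⌟) ↭-refl

      not-after : ¬ e ~ q
      not-after eq = no-longer es [] es! 0<es refl (⌞ walk ⌟ ▸⟨ eq ⟩ ⌞ Q ⌟) (↭.++-comm vs es)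

      not-between : ∀ {m m′} → Cut s e vs m m′ → m ~ q → ¬ r ~ m′
      not-between (cut {L} {R} v _ w eq) mq rm′ =
        no-longer es [] es! 0<es eq (⌞ v ⌟ ▸⟨ mq ⟩ ⌞ Q ⌟ ▸⟨ rm′ ⟩ ⌞ w ⌟)
          (solve 3 (λ l q r → l ⊕ q ⊕ r ⊜ q ⊕ l ⊕ r) ↭-refl L es R)

      -- Each comment below displays the longer path that refutes the adjacency.

      -- q ⋯ r m ⋯ s m′ ⋯ e
      start≁next : ∀ {m m′} → Cut s e vs m m′ → r ~ m → ¬ s ~ m′
      start≁next (cut v _ w eq) rm sm′ =
        no-longer es [] es! 0<es eq (⌞ Q ⌟ ▸⟨ rm ⟩ rev v ▸⟨ sm′ ⟩ ⌞ w ⌟) ↭-refl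

      -- q ⋯ r a ⋯ s e ⋯ u
      start≁end : ∀ {a u} → Cut s e vs a u → r ~ a → ¬ s ~ e
      start≁end (cut v _ w eq) ra se =
        no-longer es [] es! 0<es eq (⌞ Q ⌟ ▸⟨ ra ⟩ rev v ▸⟨ se ⟩ rev w) ↭-refl

      module _ {a b u w S₁ S₂ S₃} (σ₁ : Walk s a S₁) (σ₂ : Walk u b S₂) (σ₃ : Walk w e S₃)
               (split : vs ≡ S₁ ++ S₂ ++ S₃) (aq : a ~ q) (rb : r ~ b) where

        -- s ⋯ a q ⋯ r b ⋯ u w ⋯ e
        next≁next : ¬ u ~ w
        next≁next uw = no-longer es [] es! 0<es split (⌞ σ₁ ⌟ ▸⟨ aq ⟩ ⌞ Q ⌟ ▸⟨ rb ⟩ rev σ₂ ▸⟨ uw ⟩ ⌞ σ₃ ⌟)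
          (solve 4 (λ a b c q → a ⊕ q ⊕ b ⊕ c ⊜ q ⊕ a ⊕ b ⊕ c) ↭-refl S₁ S₂ S₃ es)

        -- s ⋯ a q ⋯ r b ⋯ u e ⋯ w
        next≁end : ¬ u ~ e
        next≁end ue = no-longer es [] es! 0<es split (⌞ σ₁ ⌟ ▸⟨ aq ⟩ ⌞ Q ⌟ ▸⟨ rb ⟩ rev σ₂ ▸⟨ ue ⟩ rev σ₃)
          (solve 4 (λ a b c q → a ⊕ q ⊕ b ⊕ c ⊜ q ⊕ a ⊕ b ⊕ c) ↭-refl S₁ S₂ S₃ es)

      -- q ⋯ r a ⋯ s m ⋯ u m′ ⋯ e, where Z is skipped
      crossingʳ : ∀ {a u m m′ L M R} Z → length Z < length es →
        Walk s a L → Walk u m M → Walk m′ e R → vs ≡ L ++ M ++ Z ++ R →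
        r ~ a → s ~ m → ¬ u ~ m′
      crossingʳ {L = L} {M} {R} Z Z<es λ′ μ ρ split ra sm um′ =
        no-longer es Z es! Z<es split (⌞ Q ⌟ ▸⟨ ra ⟩ rev λ′ ▸⟨ sm ⟩ rev μ ▸⟨ um′ ⟩ ⌞ ρ ⌟)
          (solve 5 (λ l m r z q → z ⊕ q ⊕ l ⊕ m ⊕ r ⊜ q ⊕ l ⊕ m ⊕ z ⊕ r) ↭-refl L M R Z es)

      -- q ⋯ r a ⋯ m′ s ⋯ m u ⋯ e, where Z is skipped
      crossingˡ : ∀ {a u m m′ L M R} Z → length Z < length es →
        Walk s m L → Walk m′ a M → Walk u e R → vs ≡ (L ++ Z ++ M) ++ R →
        r ~ a → m ~ u → ¬ m′ ~ s
      crossingˡ {L = L} {M} {R} Z Z<es λ′ μ ρ split ra mu m′s =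
        no-longer es Z es! Z<es split (⌞ Q ⌟ ▸⟨ ra ⟩ rev μ ▸⟨ m′s ⟩ ⌞ λ′ ⌟ ▸⟨ mu ⟩ ⌞ ρ ⌟)
          (solve 5 (λ l m r z q → z ⊕ q ⊕ m ⊕ l ⊕ r ⊜ q ⊕ (l ⊕ z ⊕ m) ⊕ r) ↭-refl L M R Z es)

-- Degrees around a rotation of the longest path

module Degrees {n : ℕ} (G : Graph (Fin n)) where

  infix 6 _~_
  _~_ : Rel (Fin n) 0ℓ
  _~_ = Adj G

  ~-sym : Symmetric _~_
  ~-sym = Graph.sym G

  NonAdj : Rel (Fin n) 0ℓ
  NonAdj u v = u ≢ v × ¬ u ~ v

  nonAdj-sym : Symmetric NonAdj
  nonAdj-sym (u≢v , u≁v) = (λ v≡u → u≢v (sym v≡u)) , (λ vu → u≁v (~-sym vu))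

  nb : Fin n → List (Fin n) → ℕ
  nb u = count (adj? G u)

  complement : ∀ {xs} → Unique xs → ∃ λ O → allFin n ↭ xs ++ O
  complement xs! = extract xs! (λ _ → ∈-allFin _)

  module _ xs {O} (p : allFin n ↭ xs ++ O) where

    length-partition : n ≡ length xs + length O
    length-partition = trans (sym (length-tabulate (λ i → i))) (trans (↭-length p) (length-++ xs))

    deg-partition : ∀ v → deg G v ≡ nb v xs + nb v O
    deg-partition v = trans (length-filter (adj? G v) (allFin n))
      (trans (count-↭ (adj? G v) p) (count-++ (adj? G v) xs O))

    outside : ∀ {z} → z ∈ O → z ∉ xs
    outside z∈O z∈xs = ++-disjoint xs (Unique-resp-↭ p (Unique.allFin⁺ n)) z∈xs z∈O refl

  open Walks _~_ ~-sym
  open Longest _~_ ~-sym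

  module _ {s e vs} (P : IsLongest s e vs) where
    open IsLongest P

    module _ {x a u} (x∉ : x ∉ vs) (c : Cut s e vs a u) (x~a : x ~ a) where
      open Cut c renaming (left to L; right to R)

      private
        x! : Unique (x ∷ vs)
        x! = ∉⇒Unique x∉ unique

      module [x] = Detour P [-] x!

      next≁off : ¬ u ~ x
      next≁off u~x = [x].not-between c (~-sym x~a) (~-sym u~x)

      -- `v` is one vertex off P that is treated separately: `x` for `deg-pair`, `y` for
      -- `deg-triple`.
      module _ {v O} (p : allFin n ↭ (v ∷ vs) ++ O) where

        n-cut : n ≡ 1 + (length L + length R) + length O
        n-cut = trans (length-partition (v ∷ vs) p)
          (cong (λ k → 1 + k + length O) (trans (cong length split) (length-++ L)))

        deg-cut : ∀ {w} → ¬ w ~ v → deg G w ≡ nb w L + nb w R + nb w O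
        deg-cut {w} w≁v = begin
          deg G w                              ≡⟨ deg-partition (v ∷ vs) p w ⟩
          bit (adj? G w v) + nb w vs + nb w O  ≡⟨ cong₂ (λ i j → i + j + nb w O)
                                                    (bit-no (adj? G w v) w≁v) (cong (nb w) split) ⟩
          nb w (L ++ R) + nb w O               ≡⟨ cong (_+ nb w O) (count-++ (adj? G w) L R) ⟩
          nb w L + nb w R + nb w O             ∎
          where open ≡-Reasoning

        deg-start : v ∉ vs → deg G s ≡ nb s L + nb s R
        deg-start v∉ = begin
          deg G s                   ≡⟨ deg-cut (off v∉) ⟩
          nb s L + nb s R + nb s O  ≡⟨ cong (nb s L + nb s R +_) (count-none (adj? G s)
                                         (λ z∈O → off (λ z∈ → outside (v ∷ vs) p z∈O (there z∈)))) ⟩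
          nb s L + nb s R + 0       ≡⟨ +-identityʳ _ ⟩
          nb s L + nb s R           ∎
          where
          open ≡-Reasoning
          off : ∀ {z} → z ∉ vs → ¬ s ~ z
          off z∉ s~z = Detour.not-before P [-] (∉⇒Unique z∉ unique) (~-sym s~z)

      start∈vs : s ∈ vs
      start∈vs = start∈ walk

      u∈vs : u ∈ vs
      u∈vs = subst (u ∈_) (sym split) (∈-++⁺ʳ L (start∈ wʳ))

      s≢u : s ≢ u
      s≢u = ++-disjoint L (subst Unique split unique) (start∈ wˡ) (start∈ wʳ)

      start-next : NonAdj s u
      start-next = s≢u , [x].start≁next c x~a

      -- On P the two degrees total at most |P| - 1; off P, s has no neighbour and u misses x.
      deg-pair : deg G s + deg G u + 2 ≤ n
      deg-pair with O , p ← complement x! = begin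
        deg G s + deg G u + 2
          ≡⟨ cong₂ (λ i j → i + j + 2) (deg-start p x∉) (deg-cut p next≁off) ⟩
        nb s L + nb s R + (nb u L + nb u R + nb u O) + 2
          ≤⟨ farkas _ _ 0 (+-mono-≤ (+-mono-≤ inR inL) (count≤length (adj? G u) O))
               (lemma (nb s L) (nb s R) (nb u L) (nb u R) (nb u O) (length L) (length R) (length O)) ⟩
        1 + (length L + length R) + length O
          ≡⟨ n-cut p ⟨
        n ∎
        where
        open ≤-Reasoning
        -- After the cut, edges from `s` are charged to their endpoint and edges from `u` to its
        -- predecessor; before the cut the roles are exchanged. At the boundaries `s` misses `e`,
        -- while the edge from `u` back to `a` costs one.
        crossʳ : ∀ {m m′} → Cut u e R m m′ → s ~ m → ¬ u ~ m′
        crossʳ (cut μ _ ρ eq) = [x].crossingʳ [] (s≤s z≤n) wˡ μ ρ (trans split (cong (L ++_) eq)) x~a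
        crossˡ : ∀ {m m′} → Cut s a L m m′ → u ~ m → ¬ s ~ m′
        crossˡ (cut λ′ _ μ eq) u~m s~m′ =
          [x].crossingˡ [] (s≤s z≤n) λ′ μ wʳ (trans split (cong (_++ R) eq)) x~a (~-sym u~m) (~-sym s~m′)
        inR : suc (nb s R + nb u R) ≤ length R + 0 + 0
        inR = ≤-trans (count-shifted (adj? G s) (adj? G u) wʳ crossʳ)
          (≤-reflexive (cong₂ (λ i j → length R + i + j) (bit-no (adj? G u u) (Graph.irrefl G u))
            (bit-no (adj? G s e) ([x].start≁end c x~a))))
        inL : suc (nb u L + nb s L) ≤ length L + 0 + 1
        inL = ≤-trans (count-shifted (adj? G u) (adj? G s) wˡ crossˡ)
          (+-mono-≤ (≤-reflexive (cong (length L +_) (bit-no (adj? G s s) (Graph.irrefl G s)))) (bit≤1 (adj? G u a)))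
        lemma : ∀ sL sR uL uR uO l r o →
          sL + sR + (uL + uR + uO) + 2 + (r + 0 + 0 + (l + 0 + 1) + o) + 0 ≡
          1 + (l + r) + o + (1 + (sR + uR) + (1 + (uL + sL)) + uO)
        lemma = solve-∀

      module _ {y} (y∉ : y ∉ vs) (x~y : x ~ y) where

        private
          y! : Unique (y ∷ vs)
          y! = ∉⇒Unique y∉ unique
          x≢y : x ≢ y
          x≢y refl = Graph.irrefl G x x~y
          xy! : Unique (x ∷ y ∷ vs)
          xy! = ∉⇒Unique (λ { (here x≡y) → x≢y x≡y ; (there x∈) → x∉ x∈ }) y!
          yx! : Unique (y ∷ x ∷ vs)
          yx! = ∉⇒Unique (λ { (here y≡x) → x≢y (sym y≡x) ; (there y∈) → y∉ y∈ }) x!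

        module [y]  = Detour P [-] y!
        module [xy] = Detour P (x~y ∷ [-]) xy!
        module [yx] = Detour P (~-sym x~y ∷ [-]) yx!

        start-off : NonAdj s y
        start-off = (λ { refl → y∉ start∈vs }) , (λ s~y → [y].not-before (~-sym s~y))

        next-off : NonAdj u y
        next-off = (λ { refl → y∉ u∈vs }) , (λ u~y → [xy].not-between c (~-sym x~a) (~-sym u~y))

        -- The edge between `x` and `y` is a detour of two vertices, so a crossing may skip a vertex
        -- of P and still lengthen it. This makes room on P for the neighbours of `y`, whose
        -- successors are adjacent to none of `s`, `u`, `y`.
        deg-triple : deg G s + deg G u + deg G y ≤ n
        deg-triple with O , p ← complement y! = begin
          deg G s + deg G u + deg G y
            ≡⟨ cong₂ _+_ (cong₂ _+_ (deg-start p y∉) (deg-cut p (proj₂ next-off))) (deg-cut p (Graph.irrefl G y)) ⟩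
          nb s L + nb s R + (nb u L + nb u R + nb u O) + (nb y L + nb y R + nb y O)
            ≤⟨ farkas _ _ 0 (+-mono-≤ (+-mono-≤ inR inL) (count-disjoint (adj? G u) (adj? G y) (inO p)))
                 (lemma (nb s L) (nb s R) (nb u L) (nb u R) (nb u O) (nb y L) (nb y R) (nb y O)
                        (length L) (length R) (length O)) ⟩
          1 + (length L + length R) + length O
            ≡⟨ n-cut p ⟨
          n ∎
          where
          open ≤-Reasoning
          -- A common neighbour `z` of `u` and `y` off P would give the longer path
          -- `s ⋯ a x y z u ⋯ e`.
          inO : ∀ {O} → allFin n ↭ (y ∷ vs) ++ O → ∀ {z} → z ∈ O → u ~ z → ¬ y ~ z
          inO p {z} z∈O u~z y~z = Detour.not-between P (x~y ∷ y~z ∷ [-]) xyz! c (~-sym x~a) (~-sym u~z)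
            where
            z∉ = outside (y ∷ vs) p z∈O
            xyz! : Unique (x ∷ y ∷ z ∷ vs)
            xyz! = ∉⇒Unique
              (λ { (here x≡y) → x≢y x≡y ; (there (here refl)) → next≁off u~z ; (there (there x∈)) → x∉ x∈ })
              (∉⇒Unique (λ { (here y≡z) → z∉ (here (sym y≡z)) ; (there y∈) → y∉ y∈ })
                (∉⇒Unique (λ z∈ → z∉ (there z∈)) unique))
          inR : nb s R + nb u R + nb y R ≤ length R + 0 + 0
          inR = ≤-trans
            (count-three (adj? G s) (adj? G u) (adj? G y) wʳ
              (λ (cut μ _ ρ eq) → [yx].crossingʳ [] (s≤s z≤n) wˡ μ ρ (trans split (cong (L ++_) eq)) x~a)
              (λ μ ρ eq → [yx].crossingʳ (_ ∷ []) (s≤s (s≤s z≤n)) wˡ μ ρ (trans split (cong (L ++_) eq)) x~a)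
              (λ k@(cut μ _ ρ eq) y~m → [y].start≁next (cutʳ c k) y~m
                , [xy].next≁next wˡ μ ρ (trans split (cong (L ++_) eq)) (~-sym x~a) y~m
                , [y].not-between (cutʳ c k) (~-sym y~m)))
            (≤-reflexive (cong₂ (λ i j → length R + i + j) (bit-no (adj? G u u) (Graph.irrefl G u))
              (bit-no (adj? G y e) (λ y~e → [y].not-after (~-sym y~e)))))
          inL : nb u L + nb s L + nb y L ≤ length L + 0 + 1
          inL = ≤-trans
            (count-three (adj? G u) (adj? G s) (adj? G y) wˡ
              (λ (cut λ′ _ μ eq) u~m s~m′ → [yx].crossingˡ [] (s≤s z≤n) λ′ μ wʳ
                (trans split (cong (_++ R) eq)) x~a (~-sym u~m) (~-sym s~m′))
              (λ λ′ μ eq u~m s~m′ → [yx].crossingˡ (_ ∷ []) (s≤s (s≤s z≤n)) λ′ μ wʳ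
                (trans split (cong (_++ R) eq)) x~a (~-sym u~m) (~-sym s~m′))
              (λ k@(cut {L′} {M} λ′ _ μ eq) y~m →
                  (λ u~m′ → [yx].next≁next λ′ μ wʳ
                    (trans split (trans (cong (_++ R) eq) (++-assoc L′ M R))) (~-sym y~m) x~a (~-sym u~m′))
                , [y].start≁next (cutˡ c k) y~m
                , [y].not-between (cutˡ c k) (~-sym y~m)))
            (+-mono-≤ (≤-reflexive (cong (length L +_) (bit-no (adj? G s s) (Graph.irrefl G s)))) (bit≤1 (adj? G y a)))
          lemma : ∀ sL sR uL uR uO yL yR yO l r o →
            sL + sR + (uL + uR + uO) + (yL + yR + yO) + (r + 0 + 0 + (l + 0 + 1) + o) + 0 ≡
            1 + (l + r) + o + (sR + uR + yR + (uL + sL + yL) + (uO + yO))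
          lemma = solve-∀

-- Induced subgraphs from embeddings

does⇒witness : {P : Set} (P? : Dec P) → does P? ≡ true → P
does⇒witness (yes p) _ = p

embedding⇒induced : ∀ {n} {W : Set} (G : Graph (Fin n)) (H : Graph W) (f : W → Fin n) →
  (∀ {v w} → f v ≡ f w → v ≡ w) → (∀ i → Dec (∃ λ w → f w ≡ i)) →
  (∀ v w → Adj G (f v) (f w) ⇔ Adj H v w) → HasInduced G H
embedding⇒induced {n} {W} G H f inj image? adj⇔ = S , record
  { bijection = mk↔ₛ′ to from to∘from from∘to
  ; adjacency = adjacency
  }
  where
  S : Subset n
  S = tabulate (λ i → does (image? i))
  ∈⁺ : ∀ w → f w ∈ₛ S
  ∈⁺ w = lookup⇒[]= (f w) S (trans (lookup∘tabulate _ (f w)) (dec-true (image? (f w)) (w , refl)))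
  ∈⁻ : ∀ {i} → i ∈ₛ S → ∃ λ w → f w ≡ i
  ∈⁻ {i} i∈S = does⇒witness (image? i) (trans (sym (lookup∘tabulate _ i)) ([]=⇒lookup i∈S))
  to : Σ (Fin n) (_∈ₛ S) → W
  to (_ , i∈S) = proj₁ (∈⁻ i∈S)
  f∘to : ∀ u → f (to u) ≡ proj₁ u
  f∘to (_ , i∈S) = proj₂ (∈⁻ i∈S)
  from : W → Σ (Fin n) (_∈ₛ S)
  from w = f w , ∈⁺ w
  to∘from : ∀ w → to (from w) ≡ w
  to∘from w = inj (f∘to (from w))
  -- Membership proofs in a `Subset` are unique, so first components determine the vertices of the
  -- induced subgraph.
  ext : ∀ {u v : Σ (Fin n) (_∈ₛ S)} → proj₁ u ≡ proj₁ v → u ≡ v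
  ext refl = cong (_ ,_) ([]=-irrelevant _ _)
  from∘to : ∀ u → from (to u) ≡ u
  from∘to u = ext (f∘to u)
  adjacency : ∀ u v → Adj G (proj₁ u) (proj₁ v) ⇔ Adj H (to u) (to v)
  adjacency u v = subst (λ i → Adj G i (proj₁ v) ⇔ Adj H (to u) (to v)) (f∘to u)
    (subst (λ i → Adj G (f (to u)) i ⇔ Adj H (to u) (to v)) (f∘to v) (adj⇔ (to u) (to v)))

lookup-allPairs : {A : Set} {R : Rel A 0ℓ} → Symmetric R → ∀ {xs} → AllPairs R xs →
                  ∀ {i j} → i ≢ j → R (lookup xs i) (lookup xs j)
lookup-allPairs R-sym (_ ∷ _)    {zero}  {zero}  i≢j = contradiction refl i≢j
lookup-allPairs R-sym (x∼ ∷ _)   {zero}  {suc j} i≢j = All.lookup x∼ (∈-lookup j)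
lookup-allPairs R-sym (x∼ ∷ _)   {suc i} {zero}  i≢j = R-sym (All.lookup x∼ (∈-lookup i))
lookup-allPairs R-sym (_ ∷ pxs)  {suc i} {suc j} i≢j = lookup-allPairs R-sym pxs (λ i≡j → i≢j (cong suc i≡j))

-- Bounds for sums over lists

module _ {A : Set} (f : A → ℕ) where
  open Nat using (_*_)

  sum-map-upper : ∀ c {xs} → (∀ {x} → x ∈ xs → f x ≤ c) → sum (map f xs) ≤ c * length xs
  sum-map-upper c {[]}     h = z≤n
  sum-map-upper c {x ∷ xs} h = ≤-trans (+-mono-≤ (h (here refl)) (sum-map-upper c (λ x∈ → h (there x∈))))
    (≤-reflexive (sym (*-suc c (length xs))))

  sum-map-lower : ∀ c {xs} → All (λ x → c ≤ f x) xs → length xs * c ≤ sum (map f xs)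
  sum-map-lower c []       = z≤n
  sum-map-lower c (h ∷ hs) = +-mono-≤ h (sum-map-lower c hs)

  -- Split the list into disjoint pairs, each used twice. If the length is odd, three entries are
  -- left at the end, and their three pairs count each of them twice.
  sum-map-pairs : ∀ c x y xs → AllPairs (λ u v → c ≤ f u + f v) (x ∷ y ∷ xs) →
                  length (x ∷ y ∷ xs) * c ≤ 2 * sum (map f (x ∷ y ∷ xs))
  sum-map-pairs c x y [] ((xy ∷ _) ∷ _) =
    farkas _ _ 0 (+-mono-≤ xy xy) (lemma c (f x) (f y))
    where
    lemma : ∀ c x y → 2 * c + (x + y + (x + y)) + 0 ≡ 2 * (x + (y + 0)) + (c + c)
    lemma = solve-∀
  sum-map-pairs c x y (z ∷ []) ((xy ∷ xz ∷ _) ∷ (yz ∷ _) ∷ _) =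
    farkas _ _ 0 (+-mono-≤ xy (+-mono-≤ xz yz)) (lemma c (f x) (f y) (f z))
    where
    lemma : ∀ c x y z → 3 * c + (x + y + (x + z + (y + z))) + 0 ≡ 2 * (x + (y + (z + 0))) + (c + (c + c))
    lemma = solve-∀
  sum-map-pairs c x y (z ∷ w ∷ xs) ((xy ∷ _) ∷ _ ∷ pxs) =
    farkas _ _ 0 (+-mono-≤ (+-mono-≤ xy xy) (sum-map-pairs c z w xs pxs))
      (lemma c (f x) (f y) (f z) (f w) (length xs) (sum (map f xs)))
    where
    lemma : ∀ c x y z w l r → (4 + l) * c + (x + y + (x + y) + 2 * (z + (w + r))) + 0 ≡
            2 * (x + (y + (z + (w + r)))) + (c + c + (2 + l) * c)
    lemma = solve-∀

-- Stars and edge counts at an independent set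

module Independent {n : ℕ} (G : Graph (Fin n)) where
  open Degrees G

  -- Neighbours of `c` in `I` are pairwise nonadjacent, so any `t` of them form a star with centre
  -- `c`; the first `t` in list order are taken.
  induced-star : ∀ t {c I} → AllPairs NonAdj I → t ≤ nb c I → HasInduced G (K₁, t)
  induced-star t {c} {I} I! t≤ = embedding⇒induced G (K₁, t) f inj image? adj⇔
    where
    N = filter (adj? G c) I
    N! : AllPairs NonAdj N
    N! = AllPairs.filter⁺ (adj? G c) I!
    t≤N : t ≤ length N
    t≤N = ≤-trans t≤ (≤-reflexive (sym (length-filter (adj? G c) I)))
    leaf : Fin t → Fin n
    leaf i = lookup N (inject≤ i t≤N)
    c~leaf : ∀ i → c ~ leaf i
    c~leaf i = All.lookup (All.all-filter (adj? G c) I) (∈-lookup (inject≤ i t≤N))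
    leaves : ∀ {i j} → i ≢ j → NonAdj (leaf i) (leaf j)
    leaves i≢j = lookup-allPairs nonAdj-sym N! (λ eq → i≢j (inject≤-injective t≤N t≤N _ _ eq))
    f : ⊤ ⊎ Fin t → Fin n
    f (inj₁ _) = c
    f (inj₂ i) = leaf i
    c≢leaf : ∀ {i} → c ≢ leaf i
    c≢leaf {i} eq = Graph.irrefl G c (subst (c ~_) (sym eq) (c~leaf i))
    inj : ∀ {v w} → f v ≡ f w → v ≡ w
    inj {inj₁ _} {inj₁ _} _  = refl
    inj {inj₁ _} {inj₂ j} eq = contradiction eq c≢leaf
    inj {inj₂ i} {inj₁ _} eq = contradiction (sym eq) c≢leaf
    inj {inj₂ i} {inj₂ j} eq with i ≟ j
    ... | yes refl = refl
    ... | no  i≢j  = contradiction eq (proj₁ (leaves i≢j))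
    image? : ∀ v → Dec (∃ λ w → f w ≡ v)
    image? v with c ≟ v | any? (λ i → leaf i ≟ v)
    ... | yes c≡v | _            = yes (inj₁ tt , c≡v)
    ... | no  _   | yes (i , eq) = yes (inj₂ i , eq)
    ... | no  c≢v | no  ∄i       = no λ { (inj₁ _ , eq) → c≢v eq ; (inj₂ i , eq) → ∄i (i , eq) }
    adj⇔ : ∀ v w → f v ~ f w ⇔ Adj (K₁, t) v w
    adj⇔ (inj₁ _) (inj₁ _) = mk⇔ (Graph.irrefl G c) λ ()
    adj⇔ (inj₁ _) (inj₂ j) = mk⇔ _ (λ _ → c~leaf j)
    adj⇔ (inj₂ i) (inj₁ _) = mk⇔ _ (λ _ → ~-sym (c~leaf i))
    adj⇔ (inj₂ i) (inj₂ j) with i ≟ j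
    ... | yes refl = mk⇔ (Graph.irrefl G (leaf i)) λ ()
    ... | no  i≢j  = mk⇔ (proj₂ (leaves i≢j)) λ ()

  -- Double counting of the edges between `xs` and `ys`.
  nb-swap : ∀ xs ys → sum (map (λ u → nb u ys) xs) ≡ sum (map (λ v → nb v xs) ys)
  nb-swap [] []       = refl
  nb-swap [] (y ∷ ys) = nb-swap [] ys
  nb-swap (x ∷ xs) ys = trans (cong (nb x ys +_) (nb-swap xs ys)) (merge ys)
    where
    bit-sym : ∀ u v → bit (adj? G u v) ≡ bit (adj? G v u)
    bit-sym u v with adj? G u v
    ... | yes uv = sym (bit-yes (adj? G v u) (~-sym uv))
    ... | no u≁v = sym (bit-no (adj? G v u) (λ vu → u≁v (~-sym vu)))
    lemma : ∀ a b c d → a + b + (c + d) ≡ a + c + (b + d)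
    lemma = solve-∀
    merge : ∀ ys → nb x ys + sum (map (λ v → nb v xs) ys) ≡ sum (map (λ v → nb v (x ∷ xs)) ys)
    merge []       = refl
    merge (y ∷ ys) = trans (lemma (bit (adj? G x y)) (nb x ys) (nb y xs) _)
      (cong₂ _+_ (cong (_+ nb y xs) (bit-sym x y)) (merge ys))

  nb-independent : ∀ {I} → AllPairs NonAdj I → ∀ {v} → v ∈ I → nb v I ≡ 0
  nb-independent I! {v} v∈I = count-none (adj? G v) (λ u∈I → none I! v∈I u∈I)
    where
    none : ∀ {I u v} → AllPairs NonAdj I → v ∈ I → u ∈ I → ¬ v ~ u
    none (_ ∷ _)  (here refl) (here refl) = Graph.irrefl G _
    none (h ∷ _)  (here refl) (there u∈)  = proj₂ (All.lookup h u∈)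
    none (h ∷ _)  (there v∈)  (here refl) = proj₂ (nonAdj-sym (All.lookup h v∈))
    none (_ ∷ I!) (there v∈)  (there u∈)  = none I! v∈ u∈

  -- Every edge at a vertex of the independent set I leaves I.
  degree-sum : ∀ {I T} → AllPairs NonAdj I → allFin n ↭ I ++ T →
               sum (map (deg G) I) ≡ sum (map (λ v → nb v I) T)
  degree-sum {I} {T} I! p = trans (go (λ u∈I → u∈I)) (nb-swap I T)
    where
    go : ∀ {J} → (∀ {u} → u ∈ J → u ∈ I) → sum (map (deg G) J) ≡ sum (map (λ u → nb u T) J)
    go {[]}    _   = refl
    go {u ∷ J} J⊆I = cong₂ _+_
      (trans (deg-partition I p u) (cong (_+ nb u T) (nb-independent I! (J⊆I (here refl)))))
      (go (λ u∈ → J⊆I (there u∈)))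

-- Numerical contradictions

module Arithmetic where
  open Nat using (_*_)

  -- Throughout, t = 5 + i, d = deg x and τ is the number of vertices that can have
  -- many neighbours in I.  Here 2d = σ + b and n = 2 + d + τ.
  large-degree : ∀ i b r τ {σ} → 5 + 2 * i + r ≡ σ → (σ + b + 4) * σ ≤ 4 * (4 + i) * τ →
    ¬ ((2 + i) * (2 * τ + σ + b + 4) + 2 ≤ 2 * (3 + i) * σ)
  -- The factors `2 + i` and `2 * (4 + i)` give `τ` the same coefficient in both hypotheses. It
  -- cancels, and the remaining quadratic inequality in `σ` and `b` fails for σ ≥ 5 + 2i.
  large-degree i b zero τ refl h₁ h₂ = <⇒≱ (s≤s z≤n) (farkas 1 0 _
    (+-mono-≤ (*-monoʳ-≤ (2 + i) h₁) (*-monoʳ-≤ (2 * (4 + i)) h₂)) (lemma i b τ))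
    where
    lemma : ∀ i b τ →
      1 + ((2 + i) * (4 * (4 + i) * τ) + 2 * (4 + i) * (2 * (3 + i) * (5 + 2 * i + 0))) +
        (2 * i * i + 9 * i + 9 + b * ((2 + i) * (5 + 2 * i) + 2 * (4 + i) * (2 + i))) ≡
      (2 + i) * ((5 + 2 * i + 0 + b + 4) * (5 + 2 * i + 0)) +
        2 * (4 + i) * ((2 + i) * (2 * τ + (5 + 2 * i + 0) + b + 4) + 2)
    lemma = solve-∀
  large-degree i b (suc r) τ refl h₁ h₂ = <⇒≱ (s≤s z≤n) (farkas 1 0 _
    (+-mono-≤ (*-monoʳ-≤ (2 + i) h₁) (*-monoʳ-≤ (2 * (4 + i)) h₂)) (lemma i b r τ))
    where
    -- The part 10 - 4r + 2r² of the slack is not coefficientwise nonnegative; after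
    -- shifting r by one it is 8 + 2r².
    lemma : ∀ i b r τ →
      1 + ((2 + i) * (4 * (4 + i) * τ) + 2 * (4 + i) * (2 * (3 + i) * (5 + 2 * i + (1 + r)))) +
        (7 + 2 * r * r + 9 * i + 2 * i * i + (1 + r) * (2 * i * i + 6 * i) + (1 + r) * (1 + r) * i
          + b * ((2 + i) * (6 + r + 2 * i) + 2 * (4 + i) * (2 + i))) ≡
      (2 + i) * ((5 + 2 * i + (1 + r) + b + 4) * (5 + 2 * i + (1 + r))) +
        2 * (4 + i) * ((2 + i) * (2 * τ + (5 + 2 * i + (1 + r)) + b + 4) + 2)
    lemma = solve-∀

  -- Here X = 2 (d + 1), h = σ - 2d - 1 and g = n - 2 - 2 (σ - d).
  small-degree : ∀ i h g r X → X ≡ 8 + 3 * i + (1 + i) * h + (2 + i) * g + r →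
    ¬ (X * X + 2 * X + 2 * X * h ≤ 8 + 2 * (4 + i) * X + 4 * (4 + i) * (2 * h + g))
  small-degree i zero g r _ refl le = <⇒≱ (s≤s z≤n) (farkas 1 0 _ le (lemma i g r))
    where
    lemma : ∀ i g r → let X = 8 + 3 * i + (1 + i) * 0 + (2 + i) * g + r in
      1 + (8 + 2 * (4 + i) * X + 4 * (4 + i) * (2 * 0 + g)) +
        (7 + 14 * i + 3 * i * i + (4 + 14 * i + 4 * i * i) * g + (10 + 4 * i) * r
          + (2 + i) * (2 + i) * (g * g) + 2 * (2 + i) * g * r + r * r) ≡
      X * X + 2 * X + 2 * X * 0
    lemma = solve-∀
  -- In the unshifted variable the slack contains 7 - 6h + 3h²; after shifting `h` by one this part
  -- is 4 + 3h².
  small-degree i (suc h) g r _ refl le = <⇒≱ (s≤s z≤n) (farkas 1 0 _ le (lemma i h g r))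
    where
    lemma : ∀ i h g r → let X = 8 + 3 * i + (1 + i) * (1 + h) + (2 + i) * g + r in
      1 + (8 + 2 * (4 + i) * X + 4 * (4 + i) * (2 * (1 + h) + g)) +
        (4 + 3 * h * h + 14 * i + 3 * i * i + (12 * i + 4 * i * i) * (1 + h)
          + (4 * i + i * i) * ((1 + h) * (1 + h)) + (4 + 14 * i + 4 * i * i) * g + (10 + 4 * i) * r
          + (2 + i) * (4 + 2 * i) * ((1 + h) * g) + (4 + 2 * i) * ((1 + h) * r)
          + (2 + i) * (2 + i) * (g * g) + 2 * (2 + i) * g * r + r * r) ≡
      X * X + 2 * X + 2 * X * (1 + h)
    lemma = solve-∀

  -- `S` is the degree sum over an independent set of `2 + d` vertices, and `b` will be the excess
  -- of `2 * d` over `σ`. The bound σ ≥ 5 + 2i follows from `ore` and σ + 2 ≤ n.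
  large-degree-absurd : ∀ i {n d σ τ S} → n ≡ 2 + d + τ → (2 + i) * n < (3 + i) * σ → σ + 2 ≤ n →
    σ ≤ 2 * d → (2 + d) * σ ≤ 2 * S → ¬ (S ≤ (4 + i) * τ)
  large-degree-absurd i {_} {d} {σ} {τ} {S} refl ore σ+2≤n σ≤2d lower upper =
    large-degree i b (proj₁ σ-large) τ (proj₂ σ-large) h₁ h₂
    where
    open ≤-Reasoning
    b : ℕ
    b = proj₁ (m≤n⇒∃[o]m+o≡n σ≤2d)
    σ+b≡2d : σ + b ≡ 2 * d
    σ+b≡2d = proj₂ (m≤n⇒∃[o]m+o≡n σ≤2d)
    lemma : ∀ i σ n → 5 + 2 * i + ((3 + i) * σ + (2 + i) * n) + 0 ≡ σ + (1 + (2 + i) * n + (2 + i) * (σ + 2))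
    lemma = solve-∀
    σ-large : ∃ λ r → 5 + 2 * i + r ≡ σ
    σ-large = m≤n⇒∃[o]m+o≡n
      (farkas _ _ 0 (+-mono-≤ ore (*-monoʳ-≤ (2 + i) σ+2≤n)) (lemma i σ (2 + d + τ)))
    h₁ : (σ + b + 4) * σ ≤ 4 * (4 + i) * τ
    h₁ = begin
      (σ + b + 4) * σ        ≡⟨ cong (λ k → (k + 4) * σ) σ+b≡2d ⟩
      (2 * d + 4) * σ        ≡⟨ lemma₁ d σ ⟩
      2 * ((2 + d) * σ)      ≤⟨ *-monoʳ-≤ 2 lower ⟩
      2 * (2 * S)            ≤⟨ *-monoʳ-≤ 2 (*-monoʳ-≤ 2 upper) ⟩
      2 * (2 * ((4 + i) * τ)) ≡⟨ lemma₂ i τ ⟩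
      4 * (4 + i) * τ        ∎
      where
      lemma₁ : ∀ d σ → (2 * d + 4) * σ ≡ 2 * ((2 + d) * σ)
      lemma₁ = solve-∀
      lemma₂ : ∀ i τ → 2 * (2 * ((4 + i) * τ)) ≡ 4 * (4 + i) * τ
      lemma₂ = solve-∀
    h₂ : (2 + i) * (2 * τ + σ + b + 4) + 2 ≤ 2 * (3 + i) * σ
    h₂ = begin
      (2 + i) * (2 * τ + σ + b + 4) + 2    ≡⟨ cong (λ k → (2 + i) * (k + 4) + 2)
                                              (trans (+-assoc (2 * τ) σ b) (cong (2 * τ +_) σ+b≡2d)) ⟩
      (2 + i) * (2 * τ + 2 * d + 4) + 2    ≡⟨ lemma₁ i τ d ⟩
      2 * (1 + (2 + i) * (2 + d + τ))      ≤⟨ *-monoʳ-≤ 2 ore ⟩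
      2 * ((3 + i) * σ)                    ≡⟨ *-assoc 2 (3 + i) σ ⟨
      2 * (3 + i) * σ                      ∎
      where
      lemma₁ : ∀ i τ d → (2 + i) * (2 * τ + 2 * d + 4) + 2 ≡ 2 * (1 + (2 + i) * (2 + d + τ))
      lemma₁ = solve-∀

  -- Here `δ` is σ - d, a lower bound for degrees of vertices nonadjacent to x. Besides I, `τ`
  -- leaves out `e`, whose contribution is the summand 1 in the upper bound.
  small-degree-absurd : ∀ i {n d δ τ S} → n ≡ 3 + d + τ → (2 + i) * n < (3 + i) * (d + δ) → 2 * δ + 2 ≤ n →
    d < δ → d + (1 + d) * δ ≤ S → ¬ (S ≤ 1 + (4 + i) * τ)
  small-degree-absurd i {_} {d} {_} {τ} n≡ ore δ≤n d<δ lower upper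
    with h , refl ← m≤n⇒∃[o]m+o≡n d<δ
    with g , refl ← m≤n⇒∃[o]m+o≡n δ≤n
    = small-degree i h g (proj₁ d-large) (2 * (1 + d))
        (trans (lemma₃ d) (trans (cong (2 +_) (sym (proj₂ d-large))) (lemma₄ i h g (proj₁ d-large))))
        -- `d-large` bounds `2 * d`, whence X = 2 (d + 1); the factor 4 turns (d + 1)² into X².
        (farkas _ _ 0 (*-monoʳ-≤ 4 (≤-trans lower (≤-trans upper (≤-reflexive (cong (λ k → 1 + (4 + i) * k) τ≡)))))
          (lemma₅ i d h g))
    where
    lemma₁ : ∀ d h g → 2 * (1 + d + h) + 2 + g ≡ 3 + d + (1 + d + 2 * h + g)
    lemma₁ = solve-∀
    τ≡ : τ ≡ 1 + d + 2 * h + g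
    τ≡ = +-cancelˡ-≡ (3 + d) τ (1 + d + 2 * h + g) (trans (sym n≡) (lemma₁ d h g))
    lemma₂ : ∀ i d h g → 6 + 3 * i + (1 + i) * h + (2 + i) * g + (3 + i) * (d + (1 + d + h)) + 0 ≡
      2 * d + (1 + (2 + i) * (2 * (1 + d + h) + 2 + g))
    lemma₂ = solve-∀
    d-large : ∃ λ r → 6 + 3 * i + (1 + i) * h + (2 + i) * g + r ≡ 2 * d
    d-large = m≤n⇒∃[o]m+o≡n (farkas _ _ 0 ore (lemma₂ i d h g))
    lemma₃ : ∀ d → 2 * (1 + d) ≡ 2 + 2 * d
    lemma₃ = solve-∀
    lemma₄ : ∀ i h g r → 2 + (6 + 3 * i + (1 + i) * h + (2 + i) * g + r) ≡ 8 + 3 * i + (1 + i) * h + (2 + i) * g + r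
    lemma₄ = solve-∀
    lemma₅ : ∀ i d h g → let X = 2 * (1 + d) in
      X * X + 2 * X + 2 * X * h + 4 * (1 + (4 + i) * (1 + d + 2 * h + g)) + 0 ≡
      8 + 2 * (4 + i) * X + 4 * (4 + i) * (2 * h + g) + 4 * (d + (1 + d) * (1 + d + h))
    lemma₅ = solve-∀

  -- The three pair bounds add up to 3σ ≤ 2 (a + b + c) ≤ 2n, but (2 + i) / (3 + i) ≥ 2/3 makes 3σ
  -- exceed 2n unless both vanish, which the strict inequality forbids.
  triple-absurd : ∀ i {n σ a b c} → (2 + i) * n < (3 + i) * σ →
    σ ≤ a + b → σ ≤ a + c → σ ≤ b + c → ¬ (a + b + c ≤ n)
  triple-absurd i {n} {σ} {a} {b} {c} ore ab ac bc abc = <⇒≱ (s≤s z≤n) (farkas 1 0 (2 + i * n)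
    (+-mono-≤ (*-monoʳ-≤ 3 ore) (*-monoʳ-≤ (3 + i) (+-mono-≤ (+-mono-≤ (+-mono-≤ ab ac) bc) (*-monoʳ-≤ 2 abc))))
    (lemma i n σ a b c))
    where
    lemma : ∀ i n σ a b c →
      1 + (3 * ((3 + i) * σ) + (3 + i) * (a + b + (a + c) + (b + c) + 2 * n)) + (2 + i * n) ≡
      3 * (1 + (2 + i) * n) + (3 + i) * (σ + σ + σ + 2 * (a + b + c))
    lemma = solve-∀

-- The independent set beside a longest path

module Ore {n : ℕ} (G : Graph (Fin n)) (i σ : ℕ) (ore : (2 + i) Nat.* n < (3 + i) Nat.* σ)
           (deg-sum : ∀ {u v} → Degrees.NonAdj G u v → σ ≤ deg G u + deg G v) where
  open Arithmetic
  open Degrees G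
  open Nat using (_*_)
  open Independent G
  open Walks _~_ ~-sym
  open Longest _~_ ~-sym

  star-unless : ∀ {I} → AllPairs NonAdj I → ¬ (∀ v → nb v I ≤ 4 + i) → HasInduced G (K₁, (5 + i))
  star-unless {I} I! many with any? (λ v → 5 + i ≤? nb v I)
  ... | yes (v , t≤) = induced-star (5 + i) I! t≤
  ... | no  ∄v       = contradiction (λ v → ≮⇒≥ (λ t≤ → ∄v (v , t≤))) many

  module _ {s e vs} (P : IsLongest s e vs) {x a u} (x∉ : x ∉ vs) (c : Cut s e vs a u) (x~a : x ~ a) where
    open IsLongest P
    open Detour P {es = x ∷ []} [-] (∉⇒Unique x∉ unique)

    neighbours-on-path : ∀ {z} → z ∉ vs → ¬ x ~ z
    neighbours-on-path z∉ x~z = triple-absurd i {a = deg G s} {deg G u} {deg G _} ore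
      (deg-sum (start-next P x∉ c x~a)) (deg-sum (start-off P x∉ c x~a z∉ x~z))
      (deg-sum (next-off P x∉ c x~a z∉ x~z))
      (deg-triple P x∉ c x~a z∉ x~z)

    B I : List (Fin n)
    B = nexts (adj? G x) walk
    I = x ∷ s ∷ B

    -- All neighbours of `x` lie on P, and `e` is not among them because P cannot be extended, so
    -- each has a successor.
    length-B : length B ≡ deg G x
    length-B with O , p ← complement (∉⇒Unique x∉ unique) = begin
      length B                             ≡⟨ +-identityʳ _ ⟨
      length B + 0                         ≡⟨ cong (length B +_)
                                                (bit-no (adj? G x e) (λ x~e → not-after (~-sym x~e))) ⟨
      length B + bit (adj? G x e)          ≡⟨ length-nexts (adj? G x) walk ⟩
      nb x vs                              ≡⟨ +-identityʳ _ ⟨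
      nb x vs + 0                          ≡⟨ cong₂ (λ j k → j + nb x vs + k) (bit-no (adj? G x x) (Graph.irrefl G x))
                                                (count-none (adj? G x) (λ z∈O →
                                                  neighbours-on-path (λ z∈ → outside (x ∷ vs) p z∈O (there z∈)))) ⟨
      bit (adj? G x x) + nb x vs + nb x O  ≡⟨ deg-partition (x ∷ vs) p x ⟨
      deg G x                              ∎
      where open ≡-Reasoning

    x-start : NonAdj x s
    x-start = (λ { refl → x∉ (start∈ walk) }) , not-before

    -- Every neighbour of `x` may play the part of `a`, so what holds for `u` holds for each member
    -- of `B`.
    I! : AllPairs NonAdj I
    I! = (x-start ∷ All.tabulate x-B) ∷ All.tabulate s-B ∷ nexts-allPairs (adj? G x) walk B-B
      where
      x-B : ∀ {w} → w ∈ B → NonAdj x w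
      x-B w∈B = let _ , k , x~m = ∈-nexts⁻ (adj? G x) walk w∈B in
        (λ { refl → x∉ (u∈vs P x∉ k x~m) }) , (λ x~w → next≁off P x∉ k x~m (~-sym x~w))
      s-B : ∀ {w} → w ∈ B → NonAdj s w
      s-B w∈B = let _ , k , x~m = ∈-nexts⁻ (adj? G x) walk w∈B in start-next P x∉ k x~m
      B-B : ∀ {m m′ l l′} (k : Cut s e vs m m′) → Cut m′ e (Cut.right k) l l′ → x ~ m → x ~ l → NonAdj m′ l′
      B-B (cut {L} {R} v _ w eq) (cut {M} v′ _ w′ eq′) x~m x~l =
        ++-disjoint M (subst Unique eq′ (Unique-++⁻ʳ L (subst Unique eq unique))) (start∈ v′) (start∈ w′) ,
        -- Otherwise `s ⋯ m x l ⋯ m′ l′ ⋯ e` would be longer.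
        next≁next v v′ w′ (trans eq (cong (L ++_) eq′)) (~-sym x~m) x~l

    σ+2≤n : σ + 2 ≤ n
    σ+2≤n = ≤-trans (+-monoˡ-≤ 2 (deg-sum (start-next P x∉ c x~a))) (deg-pair P x∉ c x~a)

    star-large-degree : σ ≤ 2 * deg G x → HasInduced G (K₁, (5 + i))
    star-large-degree σ≤2d = star-unless I! absurd
      where
      absurd : ¬ (∀ v → nb v I ≤ 4 + i)
      absurd few with T , p ← complement (AllPairs.map proj₁ I!) =
        large-degree-absurd i {d = deg G x} {τ = length T}
        (trans (length-partition I p) (cong (λ k → 2 + k + length T) length-B)) ore σ+2≤n σ≤2d
        (subst (λ k → (2 + k) * σ ≤ 2 * sum (map (deg G) I)) length-B
          (sum-map-pairs (deg G) σ x s B (AllPairs.map deg-sum I!)))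
        (≤-trans (≤-reflexive (degree-sum I! p)) (sum-map-upper (λ v → nb v I) (4 + i) {T} (λ _ → few _)))

    -- `e` misses `x` and `s`. If `l′` comes after `m′` in `B`, an edge from `e` to `m′` would give
    -- the longer path `s ⋯ m x l ⋯ m′ e ⋯ l′`; so only the last member of `B` can be adjacent to
    -- `e`.
    nb-end : nb e I ≤ 1
    nb-end
      rewrite bit-no (adj? G e x) not-after
            | bit-no (adj? G e s) (λ e~s → start≁end c x~a (~-sym e~s)) =
      count-atMostOne (adj? G e) (nexts-allPairs (adj? G x) walk
        (λ (cut {L} v _ w eq) (cut v′ _ w′ eq′) x~m x~l e~m′ →
          next≁end v v′ w′ (trans eq (cong (L ++_) eq′)) (~-sym x~m) x~l (~-sym e~m′)))

    star-small-degree : 2 * deg G x < σ → e ∉ I → HasInduced G (K₁, (5 + i))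
    star-small-degree 2d<σ e∉I = star-unless I! absurd
      where
      d δ : ℕ
      d = deg G x
      d≤σ : d ≤ σ
      d≤σ = ≤-trans (m≤m+n d _) (<⇒≤ 2d<σ)
      δ = proj₁ (m≤n⇒∃[o]m+o≡n d≤σ)
      d+δ≡σ : d + δ ≡ σ
      d+δ≡σ = proj₂ (m≤n⇒∃[o]m+o≡n d≤σ)
      δ≤ : ∀ {v} → NonAdj x v → δ ≤ deg G v
      δ≤ xv = +-cancelˡ-≤ d _ _ (≤-trans (≤-reflexive d+δ≡σ) (deg-sum xv))
      d<δ : d < δ
      d<δ = +-cancelˡ-< d d δ (≤-trans (≤-reflexive (cong (λ k → suc (d + k)) (sym (+-identityʳ d))))
        (≤-trans 2d<σ (≤-reflexive (sym d+δ≡σ))))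
      x-u : NonAdj x u
      x-u = (λ { refl → x∉ (u∈vs P x∉ c x~a) }) , (λ x~u → next≁off P x∉ c x~a (~-sym x~u))
      absurd : ¬ (∀ v → nb v I ≤ 4 + i)
      -- `e` is split off from the complement of `I`: by `nb-end` its share of the edges is at most
      -- 1 instead of `4 + i`.
      absurd few with T , p ← complement (∉⇒Unique e∉I (AllPairs.map proj₁ I!)) =
        small-degree-absurd i {d = d} {δ} {length T}
        (trans (length-partition (e ∷ I) p) (cong (λ k → 3 + k + length T) length-B))
        (subst (λ k → (2 + i) * n < (3 + i) * k) (sym d+δ≡σ) ore)
        -- Both `s` and `u` are nonadjacent to `x`, so each has degree at least `δ`.
        (≤-trans (+-monoˡ-≤ 2 (+-mono-≤ (δ≤ x-start) (≤-trans (≤-reflexive (+-identityʳ δ)) (δ≤ x-u))))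
          (deg-pair P x∉ c x~a))
        d<δ
        (+-monoʳ-≤ d (subst (λ k → (1 + k) * δ ≤ sum (map (deg G) (s ∷ B))) length-B
          (sum-map-lower (deg G) δ (All.map δ≤ (AllPairs.head I!)))))
        (≤-trans (≤-reflexive (degree-sum I! (↭-trans p (↭-sym (shift e I T)))))
          (+-mono-≤ nb-end (sum-map-upper (λ v → nb v I) (4 + i) {T} (λ _ → few _))))

  closed-walk : ∀ {a xs} → Walk a a xs → Unique xs → xs ≡ a ∷ []
  closed-walk [-]     _         = refl
  closed-walk (_ ∷ w) (a∉ ∷ _) = contradiction refl (All.lookup a∉ (end∈ w))

  module _ {s e vs} (P : IsLongest s e vs) {x} (x∉ : x ∉ vs) where
    open IsLongest P

    -- The piece of P after `m` is `e` alone. Replacing it by `x` keeps the length, so the new path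
    -- is again longest, and now it misses `e`.
    swap-end : ∀ {m} → Cut s e vs m e → x ~ m →
               ∃ λ ws → IsLongest s x ws × e ∉ ws × Cut s x ws m x
    swap-end (cut {L} {R} v e~ w eq) x~m with refl ← closed-walk w (Unique-++⁻ʳ L (subst Unique eq unique)) =
      L ++ x ∷ [] , record
        { walk    = append v (~-sym x~m) [-]
        ; unique  = AllPairs.tail e!
        ; maximal = λ w′ ys! → ≤-trans (maximal w′ ys!) (≤-reflexive lengths)
        } , (λ e∈ → All.lookup (AllPairs.head e!) e∈ refl) , cut v (~-sym x~m) [-] refl
      where
      lengths : length vs ≡ length (L ++ x ∷ [])
      lengths = trans (cong length eq) (trans (length-++ L) (sym (length-++ L)))
      e! : Unique (e ∷ L ++ x ∷ [])
      e! = Unique-resp-↭ (↭-trans (↭.++-comm (x ∷ L) (e ∷ [])) (prep e (↭.++-comm (x ∷ []) L)))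
             (subst (λ ws → Unique (x ∷ ws)) eq (∉⇒Unique x∉ unique))

    star : ∀ {a u} → Cut s e vs a u → x ~ a → HasInduced G (K₁, (5 + i))
    star c x~a with σ ≤? 2 * deg G x
    ... | yes σ≤2d = star-large-degree P x∉ c x~a σ≤2d
    ... | no  σ≰2d with _∈?_ _≟_ e (I P x∉ c x~a)
    ...   | no  e∉I = star-small-degree P x∉ c x~a (≰⇒> σ≰2d) e∉I
    ...   | yes (here refl) = contradiction (end∈ walk) x∉
    ...   | yes (there (here refl)) = contradiction refl
            (++-disjoint (Cut.left c) (subst Unique (Cut.split c) unique) (start∈ (Cut.wˡ c)) (end∈ (Cut.wʳ c)))
    -- `x` has degree below σ/2 and is nonadjacent to `e`, so `e` has degree above σ/2 and takes
    -- over the role of `x` on the exchanged path.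
    ...   | yes (there (there e∈B)) =
      let m , k , x~m = ∈-nexts⁻ (adj? G x) walk e∈B
          ws , P′ , e∉ , k′ = swap-end k x~m
      in star-large-degree P′ e∉ k′ (~-sym (Cut.edge k)) (large (deg-sum (x-end k x~m)))
      where
      x-end : ∀ {m} → Cut s e vs m e → x ~ m → NonAdj x e
      x-end k x~m = (λ { refl → x∉ (end∈ walk) }) , (λ x~e → next≁off P x∉ k x~m (~-sym x~e))
      large : σ ≤ deg G x + deg G e → σ ≤ 2 * deg G e
      large h = farkas _ _ 1 (+-mono-≤ (≰⇒> σ≰2d) (+-mono-≤ h h)) (lemma σ (deg G x) (deg G e))
        where
        lemma : ∀ σ d d′ → σ + (σ + (d + d′ + (d + d′))) + 1 ≡ 2 * d′ + (1 + 2 * d + (σ + σ))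
        lemma = solve-∀

-- Existence of a longest path and of an edge leaving it

module Search {n : ℕ} (G : Graph (Fin n)) where
  open Degrees G
  open Walks _~_ ~-sym
  open Longest _~_ ~-sym

  path? : ∀ vs → Dec (IsPath G vs)
  path? vs = map′ (λ (c , d) → record { consecutive = c ; distinct = d })
                  (λ p → IsPath.consecutive p , IsPath.distinct p)
                  (linked? (adj? G) vs ×-dec allPairs? (λ u v → ¬? (u ≟ v)) vs)

  anyOfLength? : ∀ m {Q : List (Fin n) → Set} → (∀ vs → Dec (Q vs)) → Dec (∃ λ vs → length vs ≡ m × Q vs)
  anyOfLength? zero Q? = map′ (λ q → [] , refl , q) (λ { ([] , _ , q) → q }) (Q? [])
  anyOfLength? (suc m) Q? =
    map′ (λ (v , vs , eq , q) → v ∷ vs , cong suc eq , q) (λ { (v ∷ vs , refl , q) → v , vs , refl , q })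
         (any? (λ v → anyOfLength? m (λ vs → Q? (v ∷ vs))))

  -- No path has more than `n` vertices. From that bound, lengths are tried downwards by exhaustive
  -- search until one is attained.
  longestPath : ∃ λ vs → IsPath G vs × (∀ {ws} → IsPath G ws → length ws ≤ length vs)
  longestPath = search n (λ p → bound (complement (IsPath.distinct p)))
    where
    bound : ∀ {ws} → (∃ λ O → allFin n ↭ ws ++ O) → length ws ≤ n
    bound {ws} (O , p) = ≤-trans (m≤m+n _ (length O)) (≤-reflexive (sym (length-partition ws p)))
    search : ∀ m → (∀ {ws} → IsPath G ws → length ws ≤ m) →
             ∃ λ vs → IsPath G vs × (∀ {ws} → IsPath G ws → length ws ≤ length vs)
    search m upper with anyOfLength? m path?
    search m       upper | yes (vs , refl , p) = vs , p , upper
    search zero    upper | no  _               = [] , record { consecutive = [] ; distinct = [] } , upper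
    search (suc m) upper | no  ∄m              =
      search m (λ {ws} p → ≤-pred (≤∧≢⇒< (upper p) (λ eq → ∄m (ws , eq , p))))

  linked⇒walk : ∀ {v vs} → Linked _~_ (v ∷ vs) → ∃ λ e → Walk v e (v ∷ vs)
  linked⇒walk [-]      = _ , [-]
  linked⇒walk (vw ∷ l) = let e , w = linked⇒walk l in e , vw ∷ w

  walk⇒linked : ∀ {a b vs} → Walk a b vs → Linked _~_ vs
  walk⇒linked [-]              = [-]
  walk⇒linked (e ∷ [-])        = e ∷ [-]
  walk⇒linked (e ∷ w@(_ ∷ _))  = e ∷ walk⇒linked w

  longestWalk : Fin n → ∃ λ s → ∃ λ e → ∃ λ vs → IsLongest s e vs
  longestWalk v with longestPath
  -- The one-vertex path on `v` shows that a longest path is not empty.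
  ... | [] , _ , upper with () ← upper {v ∷ []} (record { consecutive = [-] ; distinct = [] ∷ [] })
  ... | s ∷ vs , p , upper with e , w ← linked⇒walk (IsPath.consecutive p) = s , e , s ∷ vs , record
    { walk    = w
    ; unique  = IsPath.distinct p
    ; maximal = λ w′ ys! → upper (record { consecutive = walk⇒linked w′ ; distinct = ys! })
    }

  exit : ∀ {vs u v} → Star _~_ u v → u ∈ vs → v ∉ vs → ∃ λ a → ∃ λ x → a ∈ vs × x ∉ vs × a ~ x
  exit ε u∈ v∉ = contradiction u∈ v∉
  exit {vs} (_◅_ {j = w} uw ws) u∈ v∉ with _∈?_ _≟_ w vs
  ... | yes w∈ = exit ws w∈ v∉
  ... | no  w∉ = _ , _ , u∈ , w∉ , uw

  hamiltonian-or-star : ∀ i σ → (2 + i) Nat.* n < (3 + i) Nat.* σ →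
    (∀ {u v} → NonAdj u v → σ ≤ deg G u + deg G v) →
    Connected G → HasHamiltonianPath G ⊎ HasInduced G (K₁, (5 + i))
  hamiltonian-or-star i σ ore deg-sum conn with longestWalk (Connected.nonempty conn)
  ... | s , e , vs , P with all? (λ v → _∈?_ _≟_ v vs)
  ...   | yes all∈ = inj₁ (vs , record { consecutive = walk⇒linked walk ; distinct = unique } , all∈)
    where open IsLongest P
  ...   | no  ¬all∈ =
    let z , z∉ = ¬∀⟶∃¬ n (_∈ vs) (λ v → _∈?_ _≟_ v vs) ¬all∈
        a , x , a∈ , x∉ , a~x = exit (Connected.linked conn s z) (start∈ walk) z∉
        -- `a` differs from `e`, since otherwise `x` could be appended to P; so `a` has a successor.
        _ , c = cutAfter walk a∈ (λ a≡e → Detour.not-after P [-] (∉⇒Unique x∉ unique) (subst (_~ x) a≡e a~x))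
    in inj₂ (Ore.star G i σ ore deg-sum P x∉ c (~-sym a~x))
    where open IsLongest P

-- From σ₂ and rational bounds to natural numbers

σ₂≤deg-sum : ∀ {n} (G : Graph (Fin n)) {u v} → Degrees.NonAdj G u v →
             TotalOrder._≤_ ℕ⁺-totalOrder (σ₂ G) [ deg G u + deg G v ]
σ₂≤deg-sum G {u} {v} uv = All.lookup (min≤xs ℕ⁺-totalOrder ⊤⁺ _)
  (∈-map⁺ (λ (x , y) → [ deg G x + deg G y ])
    (∈-filter⁺ (λ (x , y) → ¬? (x ≟ y) ×-dec ¬? (adj? G x y)) (∈-cartesianProduct⁺ (∈-allFin u) (∈-allFin v)) uv))

module _ (i n : ℕ) where
  open Nat using (_*_)

  -- With t = 5 + i the ratio is (2 + i) / (3 + i). The order on unnormalised rationals is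
  -- cross-multiplication, so only factors 1 have to be removed.
  >⁺⇒bound : ∀ {σ t≥5} → [ σ ] >⁺ ratio (5 + i) t≥5 ℚᵘ.* fromℕ n → (2 + i) * n < (3 + i) * σ
  >⁺⇒bound {σ} {s≤s (s≤s (s≤s _))} [ ℚᵘ.*<* lt ] =
    subst₂ _<_ (*-identityʳ _) (trans (cong (σ *_) (*-identityʳ (3 + i))) (*-comm σ (3 + i)))
      (ℤ.drop‿+<+ (subst₂ ℤ._<_
        (trans (cong (ℤ._* ℤ.+ 1) (sym (ℤ.pos-* (2 + i) n))) (sym (ℤ.pos-* ((2 + i) * n) 1)))
        (sym (ℤ.pos-* σ ((3 + i) * 1))) lt))

  ⊤⁺-bound : (2 + i) * n < (3 + i) * suc n
  ⊤⁺-bound = +-mono-≤ {1} {suc n} (s≤s z≤n) (*-monoʳ-≤ (2 + i) (n≤1+n n))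

open import Data.Rational.Unnormalised.Base using (_*_)

theorem2 : (t : ℕ) (t≥5 : t ≥ 5) (n : ℕ) (G : Graph (Fin n)) →
    Connected G →
    σ₂ G >⁺ ratio t t≥5 * fromℕ n →
    HasHamiltonianPath G ⊎ HasInduced G (K₁, t)
theorem2 _ t≥5@(s≤s (s≤s (s≤s (s≤s (s≤s {n = i} z≤n))))) n G conn σ₂>
  with σ₂ G | σ₂> | (λ {u v} → σ₂≤deg-sum G {u} {v})
... | [ σ ] | σ> | σ≤ =
  Search.hamiltonian-or-star G i σ (>⁺⇒bound i n {t≥5 = t≥5} σ>) (λ uv → [≤]-injective _ (σ≤ uv)) conn
-- No two distinct vertices are nonadjacent, so any number bounds the degree sums vacuously; `suc n`
-- is large enough for the integer inequality.
... | ⊤⁺    | _  | ⊤≤ =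
  Search.hamiltonian-or-star G i (suc n) (⊤⁺-bound i n) (λ uv → contradiction (⊤≤ uv) λ ()) conn
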